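{- For all integers $n,k\ge 0$, the polynomial $$A_{n,k}(q)=\sum_{\substack{\sigma\in \mathrm{Av}_n(321)\\ \mathrm{des}\,\sigma=k}} q^{\mathrm{maj}\,\sigma}$$ is symmetric.
   Context: Let $\mathfrak S_n$ be the symmetric group of permutations $\sigma=b_1\ldots b_n$ (in one-line notation) of $[n]=\{1,\ldots,n\}$; $\mathfrak S_0$ consists of the empty permutation. Let $\mathrm{Av}_n(321)$ be the set of $\sigma=b_1\ldots b_n\in\mathfrak S_n$ avoiding the pattern $321$, i.e. such that there are no indices $i<j<l$ with $b_i>b_j>b_l$. For $\sigma=b_1\ldots b_n$ let $\mathrm{Des}\,\sigma=\{i \mid 1\le i\le n-1,\ b_i>b_{i+1}\}$, $\mathrm{des}\,\sigma=\#\mathrm{Des}\,\sigma$ (number of descents), and $\mathrm{maj}\,\sigma=\sum_{i\in\mathrm{Des}\,\sigma} i$ (major index). Equivalently, $A_{n,k}(q)$ is the coefficient of $t^k$ in $M_n(q,t)=\sum_{\sigma\in\mathrm{Av}_n(321)}q^{\mathrm{maj}\,\sigma}t^{\mathrm{des}\,\sigma}$. A polynomial $f(x)=\sum_{i=r}^s a_i x^i$ with $a_r,a_s\neq 0$ is called symmetric if $a_i=a_j$ whenever $i+j=r+s$. The zero polynomial (which occurs when no $\sigma\in\mathrm{Av}_n(321)$ has $k$ descents) is regarded as symmetric. -}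

module Defs where

open import Data.Bool.Base using (if_then_else_)
open import Data.Fin.Base using (Fin; toℕ; _<_)
import Data.Fin.Properties as Fin
open import Data.List.Base
  using (List; []; _∷_; map; foldr; filter; length; allFin; cartesianProductWith)
open import Data.Nat.Base using (ℕ; zero; suc; _+_; _≤_; _≡ᵇ_)
open import Data.Nat.ListAction using (sum)
import Data.Nat.Properties as ℕ
open import Data.Product.Base using (_×_; _,_; proj₁; proj₂; ∃; ∃₂; ∃-syntax)
open import Data.Sum.Base using (_⊎_)
open import Data.Vec.Base using (Vec; []; _∷_; lookup)
open import Function.Definitions using (Bijective)
open import Relation.Binary.PropositionalEquality using (_≡_; _≢_; refl)
open import Relation.Nullary using (¬_; Dec)
open import Relation.Nullary.Decidable using (map′; _×-dec_; _→-dec_; ¬?)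

-- The word b₁…bₙ over [n] is stored 0-based: position and letter i : Fin n
-- stand for toℕ i + 1.
Word : ℕ → Set
Word n = Vec (Fin n) n

vecsOver : {A : Set} → List A → (m : ℕ) → List (Vec A m)
vecsOver as zero    = [] ∷ []
vecsOver as (suc m) = cartesianProductWith _∷_ as (vecsOver as m)

words : (n : ℕ) → List (Word n)
words n = vecsOver (allFin n) n

IsPermutation : ∀ {n} → Word n → Set
IsPermutation σ = Bijective _≡_ _≡_ (lookup σ)

isPermutation? : ∀ {n} (σ : Word n) → Dec (IsPermutation σ)
isPermutation? σ = injective? ×-dec surjective?
  where
  injective? = map′ (λ inj {i} {j} → inj i j) (λ inj i j → inj {i} {j})
    (Fin.all? λ i → Fin.all? λ j →
      (lookup σ i Fin.≟ lookup σ j) →-dec (i Fin.≟ j))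
  surjective? = map′
    (λ sur y → proj₁ (sur y) , λ { refl → proj₂ (sur y) })
    (λ sur y → proj₁ (sur y) , proj₂ (sur y) refl)
    (Fin.all? λ y → Fin.any? λ x → lookup σ x Fin.≟ y)

𝔖 : (n : ℕ) → List (Word n)
𝔖 n = filter isPermutation? (words n)

Avoids321 : ∀ {n} → Word n → Set
Avoids321 σ = ∀ i j l → ¬ (i < j × j < l × lookup σ j < lookup σ i × lookup σ l < lookup σ j)

avoids321? : ∀ {n} (σ : Word n) → Dec (Avoids321 σ)
avoids321? σ = Fin.all? λ i → Fin.all? λ j → Fin.all? λ l →
  ¬? ((i Fin.<? j) ×-dec (j Fin.<? l)
      ×-dec (lookup σ j Fin.<? lookup σ i) ×-dec (lookup σ l Fin.<? lookup σ j))

Av321 : (n : ℕ) → List (Word n)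
Av321 n = filter avoids321? (𝔖 n)

-- The successor position j must exist, so the last position is never a descent.
IsDescent : ∀ {n} → Word n → Fin n → Set
IsDescent σ i = ∃[ j ] toℕ j ≡ suc (toℕ i) × lookup σ j < lookup σ i

isDescent? : ∀ {n} (σ : Word n) (i : Fin n) → Dec (IsDescent σ i)
isDescent? σ i = Fin.any? λ j →
  (toℕ j ℕ.≟ suc (toℕ i)) ×-dec (lookup σ j Fin.<? lookup σ i)

Des : ∀ {n} → Word n → List (Fin n)
Des {n} σ = filter (isDescent? σ) (allFin n)

des : ∀ {n} → Word n → ℕ
des σ = length (Des σ)

-- suc converts the 0-based position to the 1-based one.
maj : ∀ {n} → Word n → ℕ
maj σ = sum (map (λ i → suc (toℕ i)) (Des σ))

-- A polynomial in q with natural coefficients is given by its coefficients: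
-- f i is the coefficient of qⁱ.  Finite support is not part of the type; it is
-- part of IsSymmetric.
Coeffs : Set
Coeffs = ℕ → ℕ

0ₚ : Coeffs
0ₚ _ = 0

infixl 6 _+ₚ_
_+ₚ_ : Coeffs → Coeffs → Coeffs
(f +ₚ g) i = f i + g i

q^_ : ℕ → Coeffs
(q^ e) i = if i ≡ᵇ e then 1 else 0

∑ₚ : List Coeffs → Coeffs
∑ₚ = foldr _+ₚ_ 0ₚ

A : (n k : ℕ) → Coeffs
A n k = ∑ₚ (map (λ σ → q^ (maj σ)) (filter (λ σ → des σ ℕ.≟ k) (Av321 n)))

-- f = Σ_{i=r}^{s} aᵢ qⁱ with a_r, a_s ≠ 0.
HasSpan : Coeffs → ℕ → ℕ → Set
HasSpan f r s = f r ≢ 0 × f s ≢ 0 × (∀ i → f i ≢ 0 → r ≤ i × i ≤ s)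

-- The zero polynomial, which has no span, counts as symmetric.
IsSymmetric : Coeffs → Set
IsSymmetric f =
  (∀ i → f i ≡ 0) ⊎
  (∃₂ λ r s → HasSpan f r s × (∀ i j → i + j ≡ r + s → f i ≡ f j))

{-# OPTIONS --safe #-}
-- The reverse-complement b₁…bₙ ↦ (n+1−bₙ)…(n+1−b₁) is an involution of Avₙ(321)
-- that sends each descent i to the descent n−i.  Hence it preserves des, and it
-- sends maj to n·des − maj, so A n k is symmetric about n·k/2.
module Submission where

open import Defs
open import Data.Bool.Base using (if_then_else_)
open import Data.Fin.Base using (Fin; suc; toℕ; inject₁; fromℕ; opposite; _<_)
import Data.Fin.Properties as Fin
open import Data.Fin.Relation.Unary.Top using (view; ‵fromℕ; ‵inject₁; view-fromℕ; view-inject₁)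
open import Data.List.Base using (List; []; _∷_; map; filter; length; allFin)
open import Data.List.Membership.Propositional using (_∈_)
open import Data.List.Membership.Propositional.Properties
  using (∈-filter⁺; ∈-filter⁻; ∈-map⁺; ∈-map⁻; ∈-allFin; ∈-cartesianProductWith⁺)
open import Data.List.Membership.Propositional.Properties.WithK using (unique∧set⇒bag)
open import Data.List.Properties using (length-map; map-∘; map-cong-local)
open import Data.List.Relation.Binary.BagAndSetEquality using (∼bag⇒↭)
open import Data.List.Relation.Binary.Permutation.Propositional using (_↭_)
import Data.List.Relation.Binary.Permutation.Propositional.Properties as ↭
open import Data.List.Relation.Unary.All as All using (All; []; _∷_)
open import Data.List.Relation.Unary.All.Properties using (all-filter)
open import Data.List.Relation.Unary.Any using (here)
open import Data.List.Relation.Unary.AllPairs using ([]; _∷_)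
open import Data.List.Relation.Unary.Unique.Propositional using (Unique)
import Data.List.Relation.Unary.Unique.Propositional.Properties as Unique
open import Data.Nat.Base as ℕ using (ℕ; zero; suc; _+_; _*_; _∸_; _≤_)
open import Data.Nat.ListAction using (sum)
open import Data.Nat.ListAction.Properties using (sum-↭)
import Data.Nat.Properties as ℕ
open import Algebra.Properties.CommutativeSemigroup ℕ.+-commutativeSemigroup using (interchange)
open import Data.Product.Base using (_×_; _,_; proj₁; proj₂; ∃-syntax)
open import Data.Sum.Base using (_⊎_; inj₁; inj₂)
open import Data.Vec.Base using (Vec; []; _∷_; lookup; tabulate)
import Data.Vec.Properties as Vec
open import Function.Base using (_∘_; case_of_)
open import Function.Bundles using (mk⇔)
import Function.Construct.Composition as Compose
open import Function.Definitions using (Bijective; Injective)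
open import Relation.Binary.PropositionalEquality
open import Relation.Nullary using (yes; no; contradiction)
open import Relation.Nullary.Decidable using (does-⇔; dec-false; decidable-stable)

-- Involutions acting on duplicate-free lists.

module _ {X : Set} (ρ : X → X) (ρ-involutive : ∀ x → ρ (ρ x) ≡ x) where

  involution-injective : Injective _≡_ _≡_ ρ
  involution-injective {x} {y} eq = trans (sym (ρ-involutive x)) (trans (cong ρ eq) (ρ-involutive y))

  involution-bijective : Bijective _≡_ _≡_ ρ
  involution-bijective = involution-injective , λ y → ρ y , λ { refl → ρ-involutive y }

  -- Duplicate-free lists with the same members are permutations of each other. Injectivity of `ρ`
  -- keeps `map ρ xs` duplicate-free, so only membership has to be compared.
  map-involution-↭ : ∀ {xs ys} → Unique xs → Unique ys →
    (∀ {x} → x ∈ xs → ρ x ∈ ys) → (∀ {y} → y ∈ ys → ρ y ∈ xs) → map ρ xs ↭ ys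
  map-involution-↭ {xs} {ys} xs! ys! to from = ∼bag⇒↭
    (unique∧set⇒bag (Unique.map⁺ involution-injective xs!) ys! (mk⇔ to′ from′))
    where
    to′ : ∀ {z} → z ∈ map ρ xs → z ∈ ys
    to′ z∈ with x , x∈xs , refl ← ∈-map⁻ ρ z∈ = to x∈xs
    from′ : ∀ {z} → z ∈ ys → z ∈ map ρ xs
    from′ {z} z∈ = subst (_∈ map ρ xs) (ρ-involutive z) (∈-map⁺ ρ (from z∈))

-- Sums over lists and coefficients of sums of powers of `q`.

sum-map-complement : ∀ {X : Set} (a b : X → ℕ) {c} {xs : List X} →
  All (λ x → a x + b x ≡ c) xs → sum (map a xs) + sum (map b xs) ≡ length xs * c
sum-map-complement a b []             = refl
sum-map-complement a b (eq ∷ eqs) =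
  trans (interchange (a _) _ (b _) _) (cong₂ _+_ eq (sum-map-complement a b eqs))

∑ₚ-coeff : ∀ {X : Set} (g : X → Coeffs) xs i → ∑ₚ (map g xs) i ≡ sum (map (λ x → g x i) xs)
∑ₚ-coeff g []       i = refl
∑ₚ-coeff g (x ∷ xs) i = cong (g x i +_) (∑ₚ-coeff g xs i)

-- Cancellation in `i + j ≡ a + b` makes `i ≡ a` and `j ≡ b` equivalent, so the two coefficients are
-- decided by the same Boolean.
q^-reflect : ∀ a b i j {N} → a + b ≡ N → i + j ≡ N → (q^ a) i ≡ (q^ b) j
q^-reflect a b i j a+b i+j = cong (if_then 1 else 0)
  (does-⇔ (mk⇔ (λ { refl → ℕ.+-cancelˡ-≡ i j b i+j≡a+b })
               (λ { refl → ℕ.+-cancelʳ-≡ j i a i+j≡a+b }))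
          (i ℕ.≟ a) (j ℕ.≟ b))
  where i+j≡a+b = trans i+j (sym a+b)

∑ₚ-q^-support : ∀ {X : Set} (e : X → ℕ) {N} {xs : List X} → All (λ x → e x ≤ N) xs →
  ∀ i → ∑ₚ (map (q^_ ∘ e) xs) i ≢ 0 → i ≤ N
∑ₚ-q^-support e                []          i ≢0 = contradiction refl ≢0
∑ₚ-q^-support e {xs = x ∷ xs} (e≤N ∷ es≤N) i ≢0 with i ℕ.≟ e x
... | yes refl = e≤N
... | no i≢e   = ∑ₚ-q^-support e es≤N i λ ≡0 → ≢0
  (cong₂ _+_ (cong (if_then 1 else 0) (dec-false (i ℕ.≟ e x) i≢e)) ≡0)

-- Symmetry from a reflection of the exponents.

leastNonzero : (f : Coeffs) (b : ℕ) →
  (∀ i → i ℕ.< b → f i ≡ 0) ⊎ ∃[ r ] r ℕ.< b × f r ≢ 0 × (∀ i → i ℕ.< r → f i ≡ 0)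
leastNonzero f zero = inj₁ λ _ ()
leastNonzero f (suc b) with leastNonzero f b | f b ℕ.≟ 0
... | inj₂ (r , r<b , rest) | _ = inj₂ (r , ℕ.m<n⇒m<1+n r<b , rest)
... | inj₁ below | no fb≢0 = inj₂ (b , ℕ.n<1+n b , fb≢0 , below)
... | inj₁ below | yes fb≡0 = inj₁ λ i i<1+b → case ℕ.m<1+n⇒m<n∨m≡n i<1+b of λ where
  (inj₁ i<b)  → below i i<b
  (inj₂ refl) → fb≡0

-- The reflection `i ↦ N ∸ i` need not have `0` and `N` as the ends of the span, so the actual
-- lowest exponent `r` is searched for. The reflection carries it to the highest one, whence
-- `r + s ≡ N`.
reflective⇒symmetric : ∀ f N → (∀ i → f i ≢ 0 → i ≤ N) →
  (∀ i j → i + j ≡ N → f i ≡ f j) → IsSymmetric f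
reflective⇒symmetric f N bounded reflective with leastNonzero f (suc N)
... | inj₁ zeros = inj₁ λ i → decidable-stable (f i ℕ.≟ 0) λ fi≢0 →
  fi≢0 (zeros i (ℕ.s≤s (bounded i fi≢0)))
... | inj₂ (r , r<1+N , fr≢0 , below) = inj₂ (r , N ∸ r ,
  (fr≢0 , mirror r fr≢0 , λ i fi≢0 → lower i fi≢0 , upper i fi≢0) ,
  λ i j i+j → reflective i j (trans i+j (ℕ.m+[n∸m]≡n r≤N)))
  where
  r≤N : r ≤ N
  r≤N = ℕ.≤-pred r<1+N
  mirror : ∀ i → f i ≢ 0 → f (N ∸ i) ≢ 0
  mirror i fi≢0 = fi≢0 ∘ trans (reflective i (N ∸ i) (ℕ.m+[n∸m]≡n (bounded i fi≢0)))
  lower : ∀ i → f i ≢ 0 → r ≤ i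
  lower i fi≢0 = ℕ.≮⇒≥ (fi≢0 ∘ below i)
  upper : ∀ i → f i ≢ 0 → i ≤ N ∸ r
  -- The mirror exponent `N ∸ i` also has a nonzero coefficient, so `r ≤ N ∸ i`; adding `i` gives
  -- `i + r ≤ N`.
  upper i fi≢0 = ℕ.m+n≤o⇒m≤o∸n i (subst (i + r ≤_) (ℕ.m+[n∸m]≡n (bounded i fi≢0))
    (ℕ.+-monoʳ-≤ i (lower (N ∸ i) (mirror i fi≢0))))

-- The enumeration of words is complete and without repetition.

vecsOver-unique : ∀ {X : Set} {as : List X} → Unique as → ∀ m → Unique (vecsOver as m)
vecsOver-unique as! zero    = [] ∷ []
vecsOver-unique as! (suc m) =
  Unique.cartesianProductWith⁺ _∷_ Vec.∷-injective as! (vecsOver-unique as! m)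

∈-vecsOver : ∀ {X : Set} {as : List X} → (∀ a → a ∈ as) → ∀ {m} (v : Vec X m) → v ∈ vecsOver as m
∈-vecsOver all∈ []      = here refl
∈-vecsOver all∈ (a ∷ v) = ∈-cartesianProductWith⁺ _∷_ (all∈ a) (∈-vecsOver all∈ v)

-- Reflections of positions and letters.

opposite-anti-< : ∀ {n} {i j : Fin n} → i < j → opposite j < opposite i
opposite-anti-< {i = i} {j} i<j = subst₂ ℕ._<_ (sym (Fin.opposite-prop j)) (sym (Fin.opposite-prop i))
  (ℕ.∸-monoʳ-< (ℕ.s≤s i<j) (Fin.toℕ<n j))

opposite-cancel-< : ∀ {n} {i j : Fin n} → opposite i < opposite j → j < i
opposite-cancel-< {i = i} {j} =
  subst₂ _<_ (Fin.opposite-involutive j) (Fin.opposite-involutive i) ∘ opposite-anti-<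

-- i ↦ n − i on 1-based positions i < n.  It fixes the last position, which is
-- never a descent, so that it is a total involution.
reflect : ∀ {n} → Fin n → Fin n
reflect i with view i
... | ‵fromℕ     = fromℕ _
... | ‵inject₁ j = inject₁ (opposite j)

reflect-fromℕ : ∀ n → reflect (fromℕ n) ≡ fromℕ n
reflect-fromℕ n rewrite view-fromℕ n = refl

reflect-inject₁ : ∀ {n} (j : Fin n) → reflect (inject₁ j) ≡ inject₁ (opposite j)
reflect-inject₁ j rewrite view-inject₁ j = refl

reflect-involutive : ∀ {n} (i : Fin n) → reflect (reflect i) ≡ i
reflect-involutive i with view i
... | ‵fromℕ     = reflect-fromℕ _
... | ‵inject₁ j = trans (reflect-inject₁ (opposite j)) (cong inject₁ (Fin.opposite-involutive j))

-- The reverse-complement of a word.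

reverseComplement : ∀ {n} → Word n → Word n
reverseComplement σ = tabulate (opposite ∘ lookup σ ∘ opposite)

module _ {n} (σ : Word n) where

  private
    σᶜ = reverseComplement σ

  lookup-reverseComplement : ∀ i → lookup σᶜ i ≡ opposite (lookup σ (opposite i))
  lookup-reverseComplement = Vec.lookup∘tabulate _

  reverseComplement-involutive : reverseComplement σᶜ ≡ σ
  reverseComplement-involutive = trans (Vec.tabulate-cong pointwise) (Vec.tabulate∘lookup σ)
    where
    pointwise : opposite ∘ lookup σᶜ ∘ opposite ≗ lookup σ
    pointwise i = begin
      opposite (lookup σᶜ (opposite i))                         ≡⟨ cong opposite (lookup-reverseComplement (opposite i)) ⟩
      opposite (opposite (lookup σ (opposite (opposite i))))    ≡⟨ Fin.opposite-involutive _ ⟩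
      lookup σ (opposite (opposite i))                          ≡⟨ cong (lookup σ) (Fin.opposite-involutive i) ⟩
      lookup σ i                                                ∎
      where open ≡-Reasoning

  reverseComplement-<⁺ : ∀ i j → lookup σ (opposite j) < lookup σ (opposite i) → lookup σᶜ i < lookup σᶜ j
  reverseComplement-<⁺ i j = subst₂ _<_ (sym (lookup-reverseComplement i)) (sym (lookup-reverseComplement j))
    ∘ opposite-anti-<

  reverseComplement-<⁻ : ∀ {i j} → lookup σᶜ i < lookup σᶜ j → lookup σ (opposite j) < lookup σ (opposite i)
  reverseComplement-<⁻ {i} {j} = opposite-cancel-<
    ∘ subst₂ _<_ (lookup-reverseComplement i) (lookup-reverseComplement j)

  reverseComplement-isPermutation : IsPermutation σ → IsPermutation σᶜ
  reverseComplement-isPermutation bij = injective , surjective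
    where
    opp : Bijective _≡_ _≡_ (opposite {n})
    opp = involution-bijective opposite Fin.opposite-involutive
    conjugate : Bijective _≡_ _≡_ (opposite ∘ lookup σ ∘ opposite)
    conjugate = Compose.bijective _≡_ _≡_ _≡_ opp (Compose.bijective _≡_ _≡_ _≡_ bij opp)
    injective : Injective _≡_ _≡_ (lookup σᶜ)
    injective {i} {j} eq = proj₁ conjugate
      (trans (sym (lookup-reverseComplement i)) (trans eq (lookup-reverseComplement j)))
    surjective : ∀ y → ∃[ x ] (∀ {z} → z ≡ x → lookup σᶜ z ≡ y)
    surjective y with x , hits ← proj₂ conjugate y =
      x , λ { refl → trans (lookup-reverseComplement x) (hits refl) }

  -- The pattern 321 is its own reverse-complement: an occurrence at `i < j < l` in `σᶜ` comes from
  -- one in `σ` at the opposite positions, read backwards.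
  reverseComplement-avoids321 : Avoids321 σ → Avoids321 σᶜ
  reverseComplement-avoids321 avoids i j l (i<j , j<l , σj<σi , σl<σj) =
    avoids (opposite l) (opposite j) (opposite i)
      (opposite-anti-< j<l , opposite-anti-< i<j , reverseComplement-<⁻ σl<σj , reverseComplement-<⁻ σj<σi)

-- Descents and major index under the reverse-complement.

descent-inject₁ : ∀ {n} {σ : Word (suc n)} {i} → IsDescent σ i →
  ∃[ j ] i ≡ inject₁ j × lookup σ (suc j) < lookup σ (inject₁ j)
descent-inject₁ {σ = σ} {i} (suc j , eq , desc) =
  j , i≡j , subst (λ i → lookup σ (suc j) < lookup σ i) i≡j desc
  where
  i≡j : i ≡ inject₁ j
  i≡j = Fin.toℕ-injective (trans (sym (ℕ.suc-injective eq)) (sym (Fin.toℕ-inject₁ j)))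

-- Reversal swaps the two adjacent positions of a descent and complementation swaps the order of
-- their letters, so the two effects cancel.
reflect-descent : ∀ {n} (σ : Word n) {i} → IsDescent σ i → IsDescent (reverseComplement σ) (reflect i)
reflect-descent {suc n} σ d with j , refl , desc ← descent-inject₁ {σ = σ} d
  rewrite reflect-inject₁ j =
  suc (opposite j) , cong suc (sym (Fin.toℕ-inject₁ (opposite j))) ,
  -- Involutivity of `opposite` suffices here, since `opposite (suc k)` computes to
  -- `inject₁ (opposite k)`.
  reverseComplement-<⁺ σ (suc (opposite j)) (inject₁ (opposite j)) (subst₂ (λ a b → lookup σ a < lookup σ b)
    (sym (Fin.opposite-involutive (suc j))) (sym (cong inject₁ (Fin.opposite-involutive j))) desc)

-- In 1-based positions this reads `(n − i) + i = n`. At the last position, which `reflect` fixes,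
-- the sum would be `2n`; a descent is never there.
reflect-descent-sum : ∀ {n} (σ : Word n) {i} → IsDescent σ i → suc (toℕ (reflect i)) + suc (toℕ i) ≡ n
reflect-descent-sum {suc n} σ d with j , refl , desc ← descent-inject₁ {σ = σ} d
  rewrite reflect-inject₁ j | Fin.toℕ-inject₁ (opposite j) | Fin.toℕ-inject₁ j | Fin.opposite-prop j =
  cong suc (ℕ.m∸n+n≡m (Fin.toℕ<n j))

Des-unique : ∀ {n} (σ : Word n) → Unique (Des σ)
Des-unique {n} σ = Unique.filter⁺ (isDescent? σ) (Unique.allFin⁺ n)

reflect-Des : ∀ {n} (σ : Word n) → map reflect (Des σ) ↭ Des (reverseComplement σ)
reflect-Des {n} σ = map-involution-↭ reflect reflect-involutive (Des-unique σ) (Des-unique (reverseComplement σ))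
  (into σ _)
  -- The converse inclusion is `into` for the reverse-complement, whose own reverse-complement is
  -- `σ` again.
  (λ {i} → subst (λ τ → reflect i ∈ Des τ) (reverseComplement-involutive σ) ∘ into (reverseComplement σ) i)
  where
  into : ∀ τ i → i ∈ Des τ → reflect i ∈ Des (reverseComplement τ)
  into τ i i∈ = ∈-filter⁺ (isDescent? (reverseComplement τ)) (∈-allFin (reflect i))
    (reflect-descent τ (proj₂ (∈-filter⁻ (isDescent? τ) {xs = allFin n} i∈)))

des-reverseComplement : ∀ {n} (σ : Word n) → des (reverseComplement σ) ≡ des σ
des-reverseComplement σ = trans (sym (↭.↭-length (reflect-Des σ))) (length-map reflect (Des σ))

-- Each of the `des σ` descents, paired with its reflection, contributes `n`.
maj-reverseComplement : ∀ {n} (σ : Word n) → maj (reverseComplement σ) + maj σ ≡ des σ * n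
maj-reverseComplement {n} σ = begin
  maj (reverseComplement σ) + maj σ                         ≡⟨ cong (_+ maj σ) (sum-↭ (↭.map⁺ position (reflect-Des σ))) ⟨
  sum (map position (map reflect (Des σ))) + maj σ          ≡⟨ cong (λ xs → sum xs + maj σ) (map-∘ (Des σ)) ⟨
  sum (map (position ∘ reflect) (Des σ)) + maj σ            ≡⟨ sum-map-complement (position ∘ reflect) position
                                                                 (All.map (reflect-descent-sum σ) (all-filter (isDescent? σ) (allFin n))) ⟩
  des σ * n                                                 ∎
  where
  open ≡-Reasoning
  position : Fin n → ℕ
  position i = suc (toℕ i)

-- The 321-avoiding permutations with `k` descents and their generating polynomial.

Av321ₖ : (n k : ℕ) → List (Word n)
Av321ₖ n k = filter (λ σ → des σ ℕ.≟ k) (Av321 n)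

Av321ₖ-unique : ∀ n k → Unique (Av321ₖ n k)
Av321ₖ-unique n k = Unique.filter⁺ _ (Unique.filter⁺ avoids321? (Unique.filter⁺ isPermutation?
  (vecsOver-unique (Unique.allFin⁺ n) n)))

reverseComplement-∈ : ∀ {n k} {σ : Word n} → σ ∈ Av321ₖ n k → reverseComplement σ ∈ Av321ₖ n k
reverseComplement-∈ {n} {k} {σ} σ∈
  with σ∈Av , des≡k ← ∈-filter⁻ (λ σ → des σ ℕ.≟ k) {xs = Av321 n} σ∈
  with σ∈𝔖 , avoids ← ∈-filter⁻ avoids321? {xs = 𝔖 n} σ∈Av
  with _ , perm ← ∈-filter⁻ isPermutation? {xs = words n} σ∈𝔖 =
  ∈-filter⁺ _ (∈-filter⁺ avoids321? (∈-filter⁺ isPermutation? (∈-vecsOver ∈-allFin _)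
    (reverseComplement-isPermutation σ perm)) (reverseComplement-avoids321 σ avoids))
    (trans (des-reverseComplement σ) des≡k)

reverseComplement-Av321ₖ : ∀ n k → map reverseComplement (Av321ₖ n k) ↭ Av321ₖ n k
reverseComplement-Av321ₖ n k = map-involution-↭ reverseComplement reverseComplement-involutive
  (Av321ₖ-unique n k) (Av321ₖ-unique n k) reverseComplement-∈ reverseComplement-∈

Av321ₖ-maj : ∀ n k → All (λ σ → maj (reverseComplement σ) + maj σ ≡ k * n) (Av321ₖ n k)
Av321ₖ-maj n k = All.map (λ {σ} des≡k → trans (maj-reverseComplement σ) (cong (_* n) des≡k))
  (all-filter (λ σ → des σ ℕ.≟ k) (Av321 n))

-- Reindexing by the reverse-complement permutes the summands and replaces the exponent `maj σ` by
-- `k * n − maj σ`; then `q^-reflect` applies term by term.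
A-reflective : ∀ n k i j → i + j ≡ k * n → A n k i ≡ A n k j
A-reflective n k i j i+j = begin
  A n k i                                              ≡⟨ ∑ₚ-coeff (q^_ ∘ maj) L i ⟩
  sum (map (coeff i) L)                                ≡⟨ sum-↭ (↭.map⁺ (coeff i) (reverseComplement-Av321ₖ n k)) ⟨
  sum (map (coeff i) (map reverseComplement L))        ≡⟨ cong sum (map-∘ L) ⟨
  sum (map (coeff i ∘ reverseComplement) L)            ≡⟨ cong sum (map-cong-local
                                                            (All.map (λ {σ} eq → q^-reflect _ (maj σ) i j eq i+j) (Av321ₖ-maj n k))) ⟩
  sum (map (coeff j) L)                                ≡⟨ ∑ₚ-coeff (q^_ ∘ maj) L j ⟨
  A n k j                                              ∎
  where
  open ≡-Reasoning
  L = Av321ₖ n k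
  coeff : ℕ → Word n → ℕ
  coeff i σ = (q^ maj σ) i

theorem2p1 : (n k : ℕ) → IsSymmetric (A n k)
theorem2p1 n k = reflective⇒symmetric (A n k) (k * n)
  -- The bound `maj σ ≤ k * n` holds because `maj σ` is one of two natural summands of `k * n`.
  (∑ₚ-q^-support maj (All.map (λ {σ} eq → subst (maj σ ≤_) eq (ℕ.m≤n+m _ _)) (Av321ₖ-maj n k)))
  (A-reflective n k)
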